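{- Let $n$ be a positive integer and let $F_R(n)$ be the $n\times n$ Fibonacci--Redheffer matrix. If $\lambda_1,\lambda_2,\ldots,\lambda_n$ are the $n$ (not necessarily distinct) eigenvalues of $F_R(n)$, then \[ \det(F_R(n))=\prod_{j=1}^{n}\lambda_j = n!_F\sum_{k=1}^{n}\frac{\mu(k)}{F_k}. \]
   Context: The Fibonacci numbers are $F_1=F_2=1$, $F_n=F_{n-1}+F_{n-2}$ for $n\ge 3$. The Fibonacci--Redheffer matrix $F_R(n)=[F_R(i,j)]_{i,j=1}^n$ is defined by $F_R(i,j)=1$ if $j=1$; $F_R(i,j)=F_i$ if $i\mid j$; and $F_R(i,j)=0$ otherwise (for $i=j=1$ both rules give $1$). The Fibonacci factorial is $n!_F=\prod_{i=1}^n F_i$. $\mu$ denotes the Möbius function: $\mu(1)=1$, $\mu(j)=0$ if $j$ has a repeated prime factor, and $\mu(j)=(-1)^k$ if $j$ is a product of $k$ distinct primes. -}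

module Defs where

open import Algebra.Apartness.Bundles using (HeytingField; HeytingCommutativeRing)
open import Algebra.Bundles using (CommutativeRing)
open import Algebra.Bundles.Raw using (RawRing)
import Algebra.Definitions.RawSemiring as RawSemiringDefs
open import Algebra.Morphism.Structures using (IsRingHomomorphism)
open import Data.Bool.Base using (if_then_else_)
open import Data.Fin.Base using (Fin; zero; suc; toℕ; punchIn)
open import Data.Fin.Properties using () renaming (_≟_ to _≟ᶠ_)
open import Data.Integer.Base using (ℤ; +_; 0ℤ; -1ℤ)
import Data.Integer.Base as ℤ
open import Data.List.Base using (List; []; _∷_; map; length)
open import Data.Nat.Base using (ℕ; zero; suc; _+_; _*_; NonZero; >-nonZero; >-nonZero⁻¹)
open import Data.Nat.Divisibility using (_∣?_)
open import Data.Nat.Primality.Factorisation using (factorise; factors)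
import Data.Nat.Properties as ℕₚ
open import Data.List.Relation.Unary.Unique.DecPropositional ℕₚ._≟_ using (unique?)
open import Data.Rational.Base using (ℚ; _/_)
import Data.Rational.Base as ℚ
open import Data.Vec.Functional using (Vector)
open import Level using (Level; _⊔_)
open import Relation.Nullary.Decidable.Core using (does)

Matrix : ∀ {a} → Set a → ℕ → Set a
Matrix A n = Fin n → Fin n → A

-- Defined over a RawRing so that it applies to matrices of polynomials without
-- first proving the ring laws for polynomials.

module Determinant {c ℓ} (R : RawRing c ℓ) where
  open RawRing R renaming (_*_ to _·_; -_ to neg)
  open RawSemiringDefs rawSemiring using (sum; _^_)

  -- Laplace expansion along the first column.
  det : ∀ {n} → Matrix Carrier n → Carrier
  det {zero}  A = 1#
  det {suc n} A = sum λ i →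
    ((neg 1#) ^ toℕ i) · A i zero · det (λ r s → A (punchIn i r) (suc s))

open Determinant public

-- A polynomial is its list of coefficients, constant term first; trailing
-- zeros are identified by the coefficientwise equality.

module Polynomial {c ℓ} (R : RawRing c ℓ) where
  open RawRing R renaming (_+_ to _⊕_; _*_ to _·_; -_ to neg)

  coeff : List Carrier → ℕ → Carrier
  coeff []      _       = 0#
  coeff (a ∷ p) zero    = a
  coeff (a ∷ p) (suc k) = coeff p k

  infix  4 _≈ₚ_
  infixl 6 _+ₚ_
  infixl 7 _*ₚ_

  _≈ₚ_ : List Carrier → List Carrier → Set ℓ
  p ≈ₚ q = ∀ k → coeff p k ≈ coeff q k

  _+ₚ_ : List Carrier → List Carrier → List Carrier
  []      +ₚ q       = q
  (a ∷ p) +ₚ []      = a ∷ p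
  (a ∷ p) +ₚ (b ∷ q) = (a ⊕ b) ∷ (p +ₚ q)

  _*ₚ_ : List Carrier → List Carrier → List Carrier
  []      *ₚ q = []
  (a ∷ p) *ₚ q = map (a ·_) q +ₚ (0# ∷ (p *ₚ q))

  polyRawRing : RawRing c ℓ
  polyRawRing = record
    { Carrier = List Carrier
    ; _≈_     = _≈ₚ_
    ; _+_     = _+ₚ_
    ; _*_     = _*ₚ_
    ; -_      = map neg
    ; 0#      = []
    ; 1#      = 1# ∷ []
    }

  const : Carrier → List Carrier
  const a = a ∷ []

  X : List Carrier
  X = 0# ∷ 1# ∷ []

  X-_ : Carrier → List Carrier
  X- a = X +ₚ map neg (const a)

module Eigenvalues {c ℓ} (R : RawRing c ℓ) where
  open RawRing R using (Carrier) renaming (-_ to neg)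
  open Polynomial R
  open RawSemiringDefs (RawRing.rawSemiring polyRawRing) using (product)

  -- det (X · I − A)
  charPoly : ∀ {n} → Matrix Carrier n → List Carrier
  charPoly A = det polyRawRing λ i j →
    (if does (i ≟ᶠ j) then X else []) +ₚ map neg (const (A i j))

  -- λs lists all eigenvalues of A, each repeated according to its algebraic
  -- multiplicity.
  AreEigenvaluesOf : ∀ {n} → Vector Carrier n → Matrix Carrier n → Set ℓ
  AreEigenvaluesOf λs A = charPoly A ≈ₚ product (λ j → X- λs j)

open Eigenvalues public using (charPoly; AreEigenvaluesOf)

∏ : ∀ {c ℓ} (R : RawRing c ℓ) {n : ℕ} → Vector (RawRing.Carrier R) n → RawRing.Carrier R
∏ R = RawSemiringDefs.product (RawRing.rawSemiring R)

∑ : ∀ {c ℓ} (R : RawRing c ℓ) {n : ℕ} → Vector (RawRing.Carrier R) n → RawRing.Carrier R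
∑ R = RawSemiringDefs.sum (RawRing.rawSemiring R)

-- A field extension of ℚ, in which eigenvalues may be taken (e.g. ℂ).
-- HeytingField is the constructive notion of field satisfied by ℂ, where
-- equality is not decidable.

record ExtensionOfℚ (c ℓ₁ ℓ₂ : Level) : Set (Level.suc (c ⊔ ℓ₁ ⊔ ℓ₂)) where
  field
    heytingField : HeytingField c ℓ₁ ℓ₂

  open HeytingField heytingField public using (Carrier; _≈_; heytingCommutativeRing)

  commutativeRing : CommutativeRing c ℓ₁
  commutativeRing = HeytingCommutativeRing.commutativeRing heytingCommutativeRing

  rawRing : RawRing c ℓ₁
  rawRing = CommutativeRing.rawRing commutativeRing

  field
    ι              : ℚ → Carrier
    ι-homomorphism : IsRingHomomorphism ℚ.+-*-rawRing rawRing ι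

fib : ℕ → ℕ
fib 0             = 0
fib 1             = 1
fib (suc (suc n)) = fib (suc n) + fib n

fib-nonZero : ∀ n → NonZero (fib (suc n))
fib-nonZero zero    = _
fib-nonZero (suc n) =
  >-nonZero (ℕₚ.≤-trans (>-nonZero⁻¹ _ {{fib-nonZero n}}) (ℕₚ.m≤m+n _ _))

_!F : ℕ → ℕ
zero  !F = 1
suc n !F = n !F * fib (suc n)

μ : (n : ℕ) → .{{NonZero n}} → ℤ
μ n = if does (unique? ps) then -1ℤ ℤ.^ length ps else 0ℤ
  where ps = factors (factorise n)

fromℕ : ℕ → ℚ
fromℕ m = + m / 1

-- The entry F_R(i, j), with i and j counted from 1.
fibRedhefferEntry : (i j : ℕ) → ℕ
fibRedhefferEntry i 1 = 1
fibRedhefferEntry i j = if does (i ∣? j) then fib i else 0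

-- An index i : Fin n stands for the 1-based index suc (toℕ i).
fibRedheffer : (n : ℕ) → Matrix ℚ n
fibRedheffer n i j = fromℕ (fibRedhefferEntry (suc (toℕ i)) (suc (toℕ j)))

μ/F : (k : ℕ) → .{{NonZero k}} → ℚ
μ/F (suc k) = _/_ (μ (suc k)) (fib (suc k)) {{fib-nonZero k}}

{-# OPTIONS --safe #-}

-- Let C_i be the cofactors of the first column of F_R(n). Pairing them with
-- column s ≥ 2 gives a determinant with a repeated column, and pairing them with
-- the first standard basis vector gives the upper triangular determinant n!_F.
-- So Σ_{i∣s} F_i C_i = n!_F [s = 1] for all s ≤ n. As Σ_{i∣s} μ(i) = [s = 1] has
-- the same shape, and such divisor sums determine their summands, F_i C_i is
-- n!_F μ(i); since the first column consists of ones, det F_R(n) = Σ_i C_i.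
-- Comparing the constant terms of det(X I − A) = ∏ (X − λ_j), and cancelling
-- (−1)^n, gives det A = ∏ λ_j.
module Submission where

open import Defs
open import Algebra.Bundles using (CommutativeRing)
open import Algebra.Bundles.Raw using (RawRing)
open import Algebra.Morphism.Structures using (IsRingHomomorphism)
open import Data.Bool.Base using (true; false; if_then_else_)
open import Data.Bool.Properties using (if-float)
open import Data.Fin.Base using (Fin; zero; suc; toℕ; fromℕ<; inject₁; punchIn; lift)
import Data.Fin.Base as Fin
open import Data.Fin.Induction using (<-wellFounded)
open import Data.Fin.Properties using (punchInᵢ≢i; toℕ-injective; toℕ<n; toℕ-fromℕ; toℕ-fromℕ<; toℕ-inject₁) renaming (_≟_ to _≟ᶠ_)
open import Data.Integer.Base using (ℤ; +_; 0ℤ; 1ℤ; -1ℤ)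
import Data.Integer.Base as ℤ
import Data.Integer.Properties as ℤₚ
open import Data.List.Base using (List; []; _∷_; map; length)
open import Data.List.Membership.Propositional using (_∈_)
open import Data.List.Relation.Binary.Permutation.Propositional using (_↭_; ↭-sym; ↭⇒↭ₛ)
open import Data.List.Relation.Binary.Permutation.Propositional.Properties using (↭-length)
import Data.List.Relation.Binary.Permutation.Setoid.Properties as PermutationSetoid
open import Data.List.Relation.Unary.All using (All; _∷_)
open import Data.List.Relation.Unary.All.Properties using (¬Any⇒All¬; All¬⇒¬Any)
open import Data.List.Relation.Unary.AllPairs using (_∷_)
open import Data.Nat.Base using (ℕ; zero; suc; pred; _≤_; _<_; NonZero; z≤n; s≤s; s≤s⁻¹)
import Data.Nat.Base as ℕ
open import Data.Nat.Coprimality using (Coprime; coprime-divisor)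
open import Data.Nat.Divisibility using (_∣_; _∣?_; divides; ∣-refl; ∣-trans; ∣⇒≤; m∣m*n; *-monoʳ-∣)
open import Data.Nat.ListAction using (product)
open import Data.Nat.ListAction.Properties using (∈⇒∣product)
open import Data.Nat.Primality using (Prime; prime⇒nonZero; prime⇒irreducible)
open import Data.Nat.Primality.Factorisation using (PrimeFactorisation; factors; factorise; factorisationHasAllPrimeFactors; factorisationUnique)
import Data.Nat.Properties as ℕₚ
open import Data.List.Relation.Unary.Unique.DecPropositional ℕₚ._≟_ using (Unique; unique?)
open import Data.Product.Base using (∃; _×_; _,_)
import Data.Rational.Properties as ℚₚ
open import Data.Rational.Unnormalised.Base using (mkℚᵘ; *≡*)
import Data.Rational.Unnormalised.Base as ℚᵘ
import Data.Rational.Unnormalised.Properties as ℚᵘₚ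
open import Data.Sum.Base using (inj₁; inj₂)
open import Data.Vec.Functional using (Vector; removeAt)
open import Function.Base using (_∘_)
open import Induction.WellFounded using (Acc; acc)
open import Level using (Level)
open import Relation.Binary.PropositionalEquality.Core as ≡ using (_≡_; _≢_; _≗_)
open import Relation.Nullary using (¬_; contradiction)
open import Relation.Nullary.Decidable using (Dec; yes; no; does; dec-true; dec-false; ¬?)

-- Finite sums, indicator terms and divisor sums in a commutative ring.

module SumProperties {c ℓ} (R : CommutativeRing c ℓ) where
  open CommutativeRing R hiding (zero)
  open import Algebra.Properties.Semiring.Sum semiring public
  open import Algebra.Properties.Group +-group using () renaming (∙-cancelʳ to +-cancelʳ)
  open import Relation.Binary.Reasoning.Setoid setoid

  infix 5 _when_

  _when_ : ∀ {a} {A : Set a} → Carrier → Dec A → Carrier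
  x when A? = if does A? then x else 0#

  when-true : ∀ {a} {A : Set a} {x} (A? : Dec A) → A → (x when A?) ≡ x
  when-true {x = x} A? p = ≡.cong (if_then x else 0#) (dec-true A? p)

  when-false : ∀ {a} {A : Set a} {x} (A? : Dec A) → ¬ A → (x when A?) ≡ 0#
  when-false {x = x} A? ¬p = ≡.cong (if_then x else 0#) (dec-false A? ¬p)

  when-cong : ∀ {a} {A : Set a} {x y} (A? : Dec A) → (A → x ≈ y) → (x when A?) ≈ (y when A?)
  when-cong (yes p) x≈y = x≈y p
  when-cong (no _)  x≈y = refl

  when-zero : ∀ {a} {A : Set a} {x} (A? : Dec A) → (A → x ≈ 0#) → (x when A?) ≈ 0#
  when-zero (yes p) x≈0 = x≈0 p
  when-zero (no _)  x≈0 = refl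

  when-*ʳ : ∀ {a} {A : Set a} x y (A? : Dec A) → (x when A?) * y ≈ (x * y when A?)
  when-*ʳ x y (yes _) = refl
  when-*ʳ x y (no _)  = zeroˡ y

  sum≈0 : ∀ {n} (f : Vector Carrier n) → (∀ i → f i ≈ 0#) → sum f ≈ 0#
  sum≈0 {n} f f≈0 = trans (sum-cong-≋ f≈0) (sum-replicate-zero n)

  sum-single : ∀ {n} (f : Vector Carrier n) i → (∀ j → j ≢ i → f j ≈ 0#) → sum f ≈ f i
  sum-single {suc n} f i f≈0 = begin
    sum f                     ≈⟨ sum-remove f ⟩
    f i + sum (removeAt f i)  ≈⟨ +-congˡ (sum≈0 _ λ j → f≈0 (punchIn i j) (punchInᵢ≢i i j)) ⟩
    f i + 0#                  ≈⟨ +-identityʳ _ ⟩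
    f i                       ∎

  sum-when-single : ∀ {n p} {P : Fin n → Set p} (P? : ∀ j → Dec (P j)) (f : Vector Carrier n) i →
                    P i → (∀ j → P j → j ≡ i) → sum (λ j → f j when P? j) ≈ f i
  sum-when-single P? f i pᵢ unique = trans
    (sum-single _ i λ j j≢i → reflexive (when-false (P? j) (j≢i ∘ unique j)))
    (reflexive (when-true (P? i) pᵢ))

  sum-when-none : ∀ {n p} {P : Fin n → Set p} (P? : ∀ j → Dec (P j)) (f : Vector Carrier n) →
                  (∀ j → P j → f j ≈ 0#) → sum (λ j → f j when P? j) ≈ 0#
  sum-when-none P? f f≈0 = sum≈0 _ λ j → when-zero (P? j) (f≈0 j)

  -- Indices are shifted: f i belongs to the number i + 1, and the sum is over the
  -- divisors of s + 1 that are at most n.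
  divisorSum : ∀ {n} → Vector Carrier n → ℕ → Carrier
  divisorSum f s = sum λ i → f i when (suc (toℕ i) ∣? suc s)

  -- Strong induction on `s`: every proper divisor of the number at `s` is smaller, so all summands
  -- except the one at `s` already agree and can be cancelled.
  divisorSum-injective : ∀ {n} (f g : Vector Carrier n) →
                         (∀ (s : Fin n) → divisorSum f (toℕ s) ≈ divisorSum g (toℕ s)) →
                         ∀ s → f s ≈ g s
  divisorSum-injective {suc n} f g eq s = go s (<-wellFounded s)
    where
    term : Vector Carrier (suc n) → Fin (suc n) → Vector Carrier (suc n)
    term h s i = h i when (suc (toℕ i) ∣? suc (toℕ s))

    isolate : ∀ h s → divisorSum h (toℕ s) ≈ h s + sum (removeAt (term h s) s)
    isolate h s = trans (sum-remove (term h s))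
      (+-congʳ (reflexive (when-true (suc (toℕ s) ∣? suc (toℕ s)) ∣-refl)))

    go : ∀ s → Acc Fin._<_ s → f s ≈ g s
    go s (acc rec) = +-cancelʳ (sum (removeAt (term g s) s)) (f s) (g s) (begin
      f s + sum (removeAt (term g s) s)  ≈⟨ +-congˡ (sum-cong-≋ smaller) ⟨
      f s + sum (removeAt (term f s) s)  ≈⟨ isolate f s ⟨
      divisorSum f (toℕ s)               ≈⟨ eq s ⟩
      divisorSum g (toℕ s)               ≈⟨ isolate g s ⟩
      g s + sum (removeAt (term g s) s)  ∎)
      where
      smaller : ∀ j → removeAt (term f s) s j ≈ removeAt (term g s) s j
      smaller j = when-cong (suc (toℕ (punchIn s j)) ∣? suc (toℕ s)) λ d →
        go (punchIn s j) (rec (ℕₚ.≤∧≢⇒< (s≤s⁻¹ (∣⇒≤ d)) (punchInᵢ≢i s j ∘ toℕ-injective)))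

-- Determinants: double Laplace expansion, column swaps and alien cofactors.

module DeterminantProperties {c ℓ} (R : CommutativeRing c ℓ) where
  open CommutativeRing R hiding (zero)
  open SumProperties R
  open import Algebra.Definitions.RawSemiring (RawRing.rawSemiring rawRing) using (_^_)
  open import Algebra.Properties.Ring ring using (-1*x≈-x)
  open import Algebra.Properties.Group +-group using () renaming (⁻¹-involutive to -‿involutive)
  open import Algebra.Properties.CommutativeSemigroup *-commutativeSemigroup
    using (interchange; x∙yz≈y∙xz; xy∙z≈y∙xz)
  import Algebra.Properties.Monoid.Sum *-monoid as Product
  open import Relation.Binary.Reasoning.Setoid setoid

  Mat : ℕ → Set c
  Mat = Matrix Carrier

  ∣_∣ : ∀ {n} → Mat n → Carrier
  ∣_∣ = det rawRing

  sgn : ∀ {n} → Fin n → Carrier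
  sgn i = (- 1#) ^ toℕ i

  minor : ∀ {n} → Mat (suc n) → Fin (suc n) → Mat n
  minor A i r s = A (punchIn i r) (suc s)

  det-cong : ∀ {n} {A B : Mat n} → (∀ i j → A i j ≈ B i j) → ∣ A ∣ ≈ ∣ B ∣
  det-cong {zero}  A≈B = refl
  det-cong {suc n} {A} {B} A≈B = sum-cong-≋ terms
    where
    terms : ∀ i → sgn i * A i zero * ∣ minor A i ∣ ≈ sgn i * B i zero * ∣ minor B i ∣
    terms i = *-cong (*-congˡ (A≈B i zero)) (det-cong λ r s → A≈B (punchIn i r) (suc s))

  cofactor : ∀ {n} → Mat (suc n) → Fin (suc n) → Carrier
  cofactor A i = sgn i * ∣ minor A i ∣

  laplace : ∀ {n} (A : Mat (suc n)) → ∣ A ∣ ≈ sum (λ i → A i zero * cofactor A i)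
  laplace A = sum-cong-≋ λ i → xy∙z≈y∙xz (sgn i) (A i zero) ∣ minor A i ∣

  det-neg : ∀ {n} (A : Mat n) → ∣ (λ i j → - A i j) ∣ ≈ (- 1#) ^ n * ∣ A ∣
  det-neg {zero}  A = sym (*-identityˡ 1#)
  det-neg {suc n} A = begin
    sum (λ i → sgn i * - A i zero * ∣ (λ r s → - minor A i r s) ∣)
      ≈⟨ sum-cong-≋ (λ i → *-cong (factor (sgn i) (A i zero)) (det-neg (minor A i))) ⟩
    sum (λ i → (- 1# * (sgn i * A i zero)) * ((- 1#) ^ n * ∣ minor A i ∣))
      ≈⟨ sum-cong-≋ (λ i → interchange (- 1#) (sgn i * A i zero) ((- 1#) ^ n) ∣ minor A i ∣) ⟩
    sum (λ i → (- 1#) ^ suc n * (sgn i * A i zero * ∣ minor A i ∣))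
      ≈⟨ *-distribˡ-sum {suc n} _ (λ i → sgn i * A i zero * ∣ minor A i ∣) ⟨
    (- 1#) ^ suc n * ∣ A ∣  ∎
    where
    factor : ∀ x y → x * - y ≈ - 1# * (x * y)
    factor x y = trans (*-congˡ (sym (-1*x≈-x y))) (x∙yz≈y∙xz x (- 1#) y)

  det-upperTriangular : ∀ {n} (A : Mat n) → (∀ i j → j Fin.< i → A i j ≈ 0#) →
                        ∣ A ∣ ≈ Product.sum (λ i → A i i)
  det-upperTriangular {zero}  A A≈0 = refl
  det-upperTriangular {suc n} A A≈0 = begin
    ∣ A ∣                                                ≈⟨ sum-single _ zero below ⟩
    1# * A zero zero * ∣ minor A zero ∣                  ≈⟨ *-cong (*-identityˡ _) (det-upperTriangular _ λ i j j<i → A≈0 (suc i) (suc j) (s≤s j<i)) ⟩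
    A zero zero * Product.sum (λ i → A (suc i) (suc i))  ∎
    where
    below : ∀ i → i ≢ zero → sgn i * A i zero * ∣ minor A i ∣ ≈ 0#
    below zero    i≢0 = contradiction ≡.refl i≢0
    below (suc i) _   = begin
      sgn (suc i) * A (suc i) zero * ∣ minor A (suc i) ∣  ≈⟨ *-congʳ (*-congˡ (A≈0 (suc i) zero (s≤s z≤n))) ⟩
      sgn (suc i) * 0# * ∣ minor A (suc i) ∣              ≈⟨ *-congʳ (zeroʳ _) ⟩
      0# * ∣ minor A (suc i) ∣                            ≈⟨ zeroˡ _ ⟩
      0#                                                  ∎

  -- The term that the ordered pair of rows (i , punchIn i k) contributes to a
  -- double Laplace expansion; W collects the entries in the first two columns
  -- and P is the minor on the remaining rows.
  pairTerm : ∀ {m} → (Fin (2 ℕ.+ m) → Fin (2 ℕ.+ m) → Carrier) → ((Fin m → Fin (2 ℕ.+ m)) → Carrier) →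
             Fin (2 ℕ.+ m) → Fin (1 ℕ.+ m) → Carrier
  pairTerm W P i k = sgn i * sgn k * (W i (punchIn i k) * P (punchIn i ∘ punchIn k))

  -- Exchanging the two rows of a pair flips the sign, so a symmetric W cancels.
  -- Pairs containing row 0 cancel against each other; the others are pairs of a
  -- smaller instance.
  sum-pairTerm≈0 : ∀ {m} W (P : (Fin m → Fin (2 ℕ.+ m)) → Carrier) →
                   (∀ i j → W i j ≈ W j i) → (∀ {f g} → f ≗ g → P f ≈ P g) →
                   sum (λ i → sum (pairTerm W P i)) ≈ 0#
  sum-pairTerm≈0 {m} W P W-sym P-cong = begin
    sum (h zero) + sum (λ i → h (suc i) zero + rest i)          ≈⟨ +-congˡ (∑-distrib-+ (λ i → h (suc i) zero) rest) ⟩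
    sum (h zero) + (sum (λ i → h (suc i) zero) + sum rest)      ≈⟨ +-assoc _ _ _ ⟨
    sum (h zero) + sum (λ i → h (suc i) zero) + sum rest        ≈⟨ +-congʳ (∑-distrib-+ (h zero) (λ i → h (suc i) zero)) ⟨
    sum (λ k → h zero k + h (suc k) zero) + sum rest            ≈⟨ +-cong (sum≈0 _ cancel) (rest≈0 m W P W-sym P-cong) ⟩
    0# + 0#                                                     ≈⟨ +-identityˡ 0# ⟩
    0#                                                          ∎
    where
    h = pairTerm W P

    rest : Fin (suc m) → Carrier
    rest i = sum (λ k → h (suc i) (suc k))

    -- The two ordered pairs formed by row 0 and row `suc k` leave the same rows, since
    -- `punchIn (suc k) ∘ suc` computes to `suc ∘ punchIn k`; with `W` symmetric, only the sign
    -- differs.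
    cancel : ∀ k → h zero k + h (suc k) zero ≈ 0#
    cancel k = begin
      h zero k + h (suc k) zero                   ≈⟨ +-cong (*-congʳ (*-identityˡ _)) (*-congʳ (trans (*-identityʳ _) (-1*x≈-x _))) ⟩
      sgn k * (W zero (suc k) * Pₖ) + - sgn k * (W (suc k) zero * Pₖ)
                                                  ≈⟨ +-congˡ (*-congˡ (*-congʳ (W-sym (suc k) zero))) ⟩
      sgn k * (W zero (suc k) * Pₖ) + - sgn k * (W zero (suc k) * Pₖ)
                                                  ≈⟨ distribʳ _ _ _ ⟨
      (sgn k + - sgn k) * (W zero (suc k) * Pₖ)   ≈⟨ *-congʳ (-‿inverseʳ _) ⟩
      0# * (W zero (suc k) * Pₖ)                  ≈⟨ zeroˡ _ ⟩
      0#                                          ∎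
      where Pₖ = P (suc ∘ punchIn k)

    sgn-suc² : ∀ x y → (- 1# * x) * (- 1# * y) ≈ x * y
    sgn-suc² x y = begin
      (- 1# * x) * (- 1# * y)  ≈⟨ interchange (- 1#) x (- 1#) y ⟩
      (- 1# * - 1#) * (x * y)  ≈⟨ *-congʳ (trans (-1*x≈-x (- 1#)) (-‿involutive 1#)) ⟩
      1# * (x * y)             ≈⟨ *-identityˡ _ ⟩
      x * y                    ∎

    rest≈0 : ∀ m W (P : (Fin m → Fin (2 ℕ.+ m)) → Carrier) →
             (∀ i j → W i j ≈ W j i) → (∀ {f g} → f ≗ g → P f ≈ P g) →
             sum (λ i → sum (λ k → pairTerm W P (suc i) (suc k))) ≈ 0#
    -- Among two rows no pair avoids row 0, so the inner sum is empty.
    rest≈0 zero    W P W-sym P-cong = +-identityˡ 0#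
    rest≈0 (suc m) W P W-sym P-cong = trans
      -- Row 0 is not in the pair, so it stays on top of the remaining rows; `lift 1` records this.
      -- The row selections agree only pointwise, hence the congruence hypothesis on `P`.
      (sum-cong-≋ λ i → sum-cong-≋ (step i))
      (sum-pairTerm≈0 W′ (P ∘ lift 1) (λ i j → W-sym (suc i) (suc j))
        λ f≗g → P-cong λ { zero → ≡.refl ; (suc r) → ≡.cong suc (f≗g r) })
      where
      W′ : Fin (2 ℕ.+ m) → Fin (2 ℕ.+ m) → Carrier
      W′ i j = W (suc i) (suc j)

      punchIn² : ∀ i k r → punchIn (suc i) (punchIn (suc k) r) ≡ lift 1 (punchIn i ∘ punchIn k) r
      punchIn² i k zero    = ≡.refl
      punchIn² i k (suc r) = ≡.refl

      step : ∀ i k → pairTerm W P (suc i) (suc k) ≈ pairTerm W′ (P ∘ lift 1) i k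
      step i k = *-cong (sgn-suc² (sgn i) (sgn k)) (*-congˡ (P-cong (punchIn² i k)))

  module _ {m : ℕ} (A : Mat (2 ℕ.+ m)) where
    private
      col₀ col₁ : Fin (2 ℕ.+ m) → Carrier
      col₀ i = A i zero
      col₁ i = A i (suc zero)

    minor₂ : (Fin m → Fin (2 ℕ.+ m)) → Carrier
    minor₂ f = ∣ (λ r s → A (f r) (suc (suc s))) ∣

    minor₂-cong : ∀ {f g} → f ≗ g → minor₂ f ≈ minor₂ g
    minor₂-cong f≗g = det-cong λ r s → reflexive (≡.cong (λ i → A i (suc (suc s))) (f≗g r))

    -- Each minor is expanded along its own first column; its row `k` is row `punchIn i k` of `A`.
    laplace₂ : ∣ A ∣ ≈ sum (λ i → sum (pairTerm (λ i j → col₀ i * col₁ j) minor₂ i))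
    laplace₂ = sum-cong-≋ λ i → trans
      (*-distribˡ-sum (sgn i * col₀ i) λ k → sgn k * col₁ (punchIn i k) * P i k)
      (sum-cong-≋ (regroup i))
      where
      P : Fin (2 ℕ.+ m) → Fin (1 ℕ.+ m) → Carrier
      P i k = minor₂ (punchIn i ∘ punchIn k)

      regroup : ∀ i k → sgn i * col₀ i * (sgn k * col₁ (punchIn i k) * P i k) ≈
                        sgn i * sgn k * (col₀ i * col₁ (punchIn i k) * P i k)
      regroup i k = begin
        sgn i * col₀ i * (sgn k * col₁ (punchIn i k) * P i k)  ≈⟨ *-assoc _ _ _ ⟨
        sgn i * col₀ i * (sgn k * col₁ (punchIn i k)) * P i k  ≈⟨ *-congʳ (interchange _ _ _ _) ⟩
        sgn i * sgn k * (col₀ i * col₁ (punchIn i k)) * P i k  ≈⟨ *-assoc _ _ _ ⟩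
        sgn i * sgn k * (col₀ i * col₁ (punchIn i k) * P i k)  ∎

  swapCols : ∀ {m} → Mat (2 ℕ.+ m) → Mat (2 ℕ.+ m)
  swapCols A i zero          = A i (suc zero)
  swapCols A i (suc zero)    = A i zero
  swapCols A i (suc (suc s)) = A i (suc (suc s))

  -- The swap exchanges the two column factors of the weight and leaves the minors on the other
  -- columns alone. The two weights add up to a symmetric one, which `sum-pairTerm≈0` annihilates.
  det-swapCols : ∀ {m} (A : Mat (2 ℕ.+ m)) → ∣ swapCols A ∣ + ∣ A ∣ ≈ 0#
  det-swapCols A = begin
    ∣ swapCols A ∣ + ∣ A ∣  ≈⟨ +-cong (laplace₂ (swapCols A)) (laplace₂ A) ⟩
    sum (λ i → sum (pairTerm W₁ P i)) + sum (λ i → sum (pairTerm W₂ P i))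
      ≈⟨ ∑-distrib-+ (λ i → sum (pairTerm W₁ P i)) (λ i → sum (pairTerm W₂ P i)) ⟨
    sum (λ i → sum (pairTerm W₁ P i) + sum (pairTerm W₂ P i))
      ≈⟨ sum-cong-≋ (λ i → trans (sym (∑-distrib-+ (pairTerm W₁ P i) (pairTerm W₂ P i)))
           (sum-cong-≋ (pairTerm-+ i))) ⟩
    sum (λ i → sum (pairTerm W₁+W₂ P i))
      ≈⟨ sum-pairTerm≈0 W₁+W₂ P W₁+W₂-sym (minor₂-cong A) ⟩
    0#  ∎
    where
    P = minor₂ A

    W₁ W₂ W₁+W₂ : Fin _ → Fin _ → Carrier
    W₁ i j = A i (suc zero) * A j zero
    W₂ i j = A i zero * A j (suc zero)
    W₁+W₂ i j = W₁ i j + W₂ i j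

    W₁+W₂-sym : ∀ i j → W₁+W₂ i j ≈ W₁+W₂ j i
    W₁+W₂-sym i j = trans (+-comm (W₁ i j) (W₂ i j)) (+-cong (*-comm _ _) (*-comm _ _))

    pairTerm-+ : ∀ i k → pairTerm W₁ P i k + pairTerm W₂ P i k ≈ pairTerm W₁+W₂ P i k
    pairTerm-+ i k = trans (sym (distribˡ _ _ _)) (*-congˡ (sym (distribʳ _ _ _)))

  -- If the copy is the next column, the weight of the double expansion is symmetric. Otherwise
  -- swapping the first two columns moves the repeated column into the minors, which vanish by
  -- induction, and `det-swapCols` carries this back. Nowhere is 2 cancelled, so the characteristic
  -- is arbitrary.
  det-repeatedFirstCol : ∀ {n} (A : Mat (suc n)) s → (∀ i → A i zero ≈ A i (suc s)) → ∣ A ∣ ≈ 0#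
  det-repeatedFirstCol A zero eq = trans (laplace₂ A) (sum-pairTerm≈0 W (minor₂ A) W-sym (minor₂-cong A))
    where
    W : Fin _ → Fin _ → Carrier
    W i j = A i zero * A j (suc zero)

    W-sym : ∀ i j → W i j ≈ W j i
    W-sym i j = trans (*-cong (eq i) (sym (eq j))) (*-comm _ _)
  det-repeatedFirstCol {suc n} A (suc s) eq = begin
    ∣ A ∣                   ≈⟨ +-identityˡ _ ⟨
    0# + ∣ A ∣              ≈⟨ +-congʳ swapped ⟨
    ∣ swapCols A ∣ + ∣ A ∣  ≈⟨ det-swapCols A ⟩
    0#                      ∎
    where
    swapped : ∣ swapCols A ∣ ≈ 0#
    swapped = sum≈0 _ λ i → trans
      (*-congˡ {sgn i * A i (suc zero)} (det-repeatedFirstCol (minor (swapCols A) i) s λ r → eq (punchIn i r)))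
      (zeroʳ _)

  -- Cofactors do not see the first column, so those of `A` are also those of `A′`, where column
  -- `suc s` replaces column 0 and thus occurs twice.
  laplace-alien : ∀ {n} (A : Mat (suc n)) s → sum (λ i → A i (suc s) * cofactor A i) ≈ 0#
  laplace-alien A s = trans (sym (laplace A′)) (det-repeatedFirstCol A′ s λ _ → refl)
    where
    A′ : Mat _
    A′ i zero    = A i (suc s)
    A′ i (suc j) = A i (suc j)

  product-neg : ∀ {n} (f : Vector Carrier n) → Product.sum (λ i → - f i) ≈ (- 1#) ^ n * Product.sum f
  product-neg {zero}  f = sym (*-identityˡ 1#)
  product-neg {suc n} f = trans
    (*-cong (sym (-1*x≈-x (f zero))) (product-neg (f ∘ suc)))
    (interchange (- 1#) (f zero) ((- 1#) ^ n) _)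

  -- Negating both sides strips one factor at a time, because negation is involutive.
  -1^n-cancel : ∀ n {x y} → (- 1#) ^ n * x ≈ (- 1#) ^ n * y → x ≈ y
  -1^n-cancel zero    eq = trans (sym (*-identityˡ _)) (trans eq (*-identityˡ _))
  -1^n-cancel (suc n) {x} {y} eq = -1^n-cancel n (begin
    (- 1#) ^ n * x            ≈⟨ -‿involutive _ ⟨
    - - ((- 1#) ^ n * x)      ≈⟨ -‿cong (step x) ⟨
    - ((- 1#) ^ suc n * x)    ≈⟨ -‿cong eq ⟩
    - ((- 1#) ^ suc n * y)    ≈⟨ -‿cong (step y) ⟩
    - - ((- 1#) ^ n * y)      ≈⟨ -‿involutive _ ⟩
    (- 1#) ^ n * y            ∎)
    where
    step : ∀ z → (- 1#) ^ suc n * z ≈ - ((- 1#) ^ n * z)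
    step z = trans (*-assoc _ _ _) (-1*x≈-x _)

  -- Ring homomorphisms applied to sums, products and determinants.

  module _ {c′ ℓ′} {S : RawRing c′ ℓ′} {⟦_⟧ : RawRing.Carrier S → Carrier}
           (homomorphism : IsRingHomomorphism S rawRing ⟦_⟧) where
    private module S = RawRing S
    open IsRingHomomorphism homomorphism using (+-homo; *-homo; 0#-homo; 1#-homo; -‿homo)

    sum-homo : ∀ {n} (f : Vector S.Carrier n) → ⟦ ∑ S f ⟧ ≈ sum (λ i → ⟦ f i ⟧)
    sum-homo {zero}  f = 0#-homo
    sum-homo {suc n} f = trans (+-homo _ _) (+-congˡ (sum-homo (f ∘ suc)))

    product-homo : ∀ {n} (f : Vector S.Carrier n) → ⟦ ∏ S f ⟧ ≈ Product.sum (λ i → ⟦ f i ⟧)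
    product-homo {zero}  f = 1#-homo
    product-homo {suc n} f = trans (*-homo _ _) (*-congˡ (product-homo (f ∘ suc)))

    private
      open import Algebra.Definitions.RawSemiring S.rawSemiring using () renaming (_^_ to _^ₛ_)

      sgn-homo : ∀ k → ⟦ (S.- S.1#) ^ₛ k ⟧ ≈ (- 1#) ^ k
      sgn-homo zero    = 1#-homo
      sgn-homo (suc k) = trans (*-homo _ _) (*-cong (trans (-‿homo _) (-‿cong 1#-homo)) (sgn-homo k))

    -- The source is a `RawRing`, so this covers coefficient lists, for which no ring laws are
    -- proved, as well as the embedding `ι`.
    det-homo : ∀ {n} (A : Matrix S.Carrier n) → ⟦ det S A ⟧ ≈ ∣ (λ i j → ⟦ A i j ⟧) ∣
    det-homo {zero}  A = 1#-homo
    det-homo {suc n} A = trans (sum-homo term) (sum-cong-≋ term-homo)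
      where
      term : Vector S.Carrier (suc n)
      term i = ((S.- S.1#) ^ₛ toℕ i) S.* A i zero S.* det S (λ r s → A (punchIn i r) (suc s))

      term-homo : ∀ i → ⟦ term i ⟧ ≈ sgn i * ⟦ A i zero ⟧ * ∣ minor (λ i j → ⟦ A i j ⟧) i ∣
      term-homo i = trans (*-homo _ _)
        (*-cong (trans (*-homo _ _) (*-congʳ (sgn-homo (toℕ i)))) (det-homo λ r s → A (punchIn i r) (suc s)))

-- Characteristic polynomials and the product of the eigenvalues.

module EigenvalueProperties {c ℓ} (R : CommutativeRing c ℓ) where
  open CommutativeRing R hiding (zero)
  open DeterminantProperties R
  open Polynomial rawRing
  open import Algebra.Definitions.RawSemiring (RawRing.rawSemiring rawRing) using (_^_)
  open import Algebra.Properties.Group +-group using () renaming (ε⁻¹≈ε to -0#≈0#)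
  import Algebra.Properties.Monoid.Sum *-monoid as Product
  open import Relation.Binary.Reasoning.Setoid setoid

  constantTerm : List Carrier → Carrier
  constantTerm p = coeff p 0

  -- This is evaluation at `X` = 0, which carries X I - A to -A and X - λ_j to -λ_j; as a
  -- homomorphism it passes through `det` and the product.
  constantTerm-isRingHomomorphism : IsRingHomomorphism polyRawRing rawRing constantTerm
  constantTerm-isRingHomomorphism = record
    { isSemiringHomomorphism = record
      { isNearSemiringHomomorphism = record
        { +-isMonoidHomomorphism = record
          { isMagmaHomomorphism = record
            { isRelHomomorphism = record { cong = λ p≈q → p≈q 0 }
            ; homo = +-homo
            }
          ; ε-homo = refl
          }
        ; *-homo = *-homo
        }
      ; 1#-homo = refl
      }
    ; -‿homo = -‿homo
    }
    where
    +-homo : ∀ p q → constantTerm (p +ₚ q) ≈ constantTerm p + constantTerm q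
    +-homo []      q       = sym (+-identityˡ _)
    +-homo (a ∷ p) []      = sym (+-identityʳ _)
    +-homo (a ∷ p) (b ∷ q) = refl

    *-homo : ∀ p q → constantTerm (p *ₚ q) ≈ constantTerm p * constantTerm q
    *-homo []      q       = sym (zeroˡ _)
    *-homo (a ∷ p) []      = sym (zeroʳ _)
    *-homo (a ∷ p) (b ∷ q) = +-identityʳ _

    -‿homo : ∀ p → constantTerm (map -_ p) ≈ - constantTerm p
    -‿homo []      = sym -0#≈0#
    -‿homo (a ∷ p) = refl

  det≈product-eigenvalues : ∀ {n} (A : Mat n) (λs : Vector Carrier n) →
                            AreEigenvaluesOf rawRing λs A → ∣ A ∣ ≈ Product.sum λs
  det≈product-eigenvalues {n} A λs eq = -1^n-cancel n (begin
    (- 1#) ^ n * ∣ A ∣                            ≈⟨ det-neg A ⟨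
    ∣ (λ i j → - A i j) ∣                         ≈⟨ det-cong entry ⟨
    ∣ (λ i j → constantTerm (X-A i j)) ∣          ≈⟨ det-homo constantTerm-isRingHomomorphism X-A ⟨
    constantTerm (charPoly rawRing A)             ≈⟨ eq 0 ⟩
    constantTerm (∏ polyRawRing (λ j → X- λs j))  ≈⟨ product-homo constantTerm-isRingHomomorphism (λ j → X- λs j) ⟩
    Product.sum (λ j → 0# + - λs j)               ≈⟨ Product.sum-cong-≋ (λ j → +-identityˡ (- λs j)) ⟩
    Product.sum (λ j → - λs j)                    ≈⟨ product-neg λs ⟩
    (- 1#) ^ n * Product.sum λs                   ∎)
    where
    X-A : Matrix (List Carrier) n
    X-A i j = (if does (i ≟ᶠ j) then X else []) +ₚ map -_ (const (A i j))

    entry : ∀ i j → constantTerm (X-A i j) ≈ - A i j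
    entry i j with does (i ≟ᶠ j)
    ... | true  = +-identityˡ _
    ... | false = refl

-- Prime factorisations and the Möbius function at a multiple of a prime.

open import Relation.Binary.PropositionalEquality using (refl; sym; trans; cong; cong₂; subst; setoid; module ≡-Reasoning)

Unique-resp-↭ : ∀ {xs ys : List ℕ} → xs ↭ ys → Unique xs → Unique ys
Unique-resp-↭ = PermutationSetoid.Unique-resp-↭ (setoid ℕ) ∘ ↭⇒↭ₛ

module _ {n p e : ℕ} .{{_ : NonZero n}} .{{_ : NonZero e}} (p-prime : Prime p) (n≡p*e : n ≡ p ℕ.* e) where
  private
    f = factorise e
    f′ = factorise n
    open PrimeFactorisation f using (isFactorisation; factorsPrime)

    -- By uniqueness of factorisation: `p` in front of the factors of `e` factorises `n`. The number
    -- `n` is kept apart from `p * e` because it will have the form `suc (toℕ d)`.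
    factors-* : factors f′ ↭ p ∷ factors f
    factors-* = factorisationUnique f′ record
      { factors         = p ∷ factors f
      ; isFactorisation = trans n≡p*e (cong (p ℕ.*_) isFactorisation)
      ; factorsPrime    = p-prime ∷ factorsPrime
      }

  -- `p` is already among the factors of `e`, so it occurs twice among those of `n`.
  μ[p*e]≡0 : p ∣ e → μ n ≡ 0ℤ
  μ[p*e]≡0 p∣e = cong (if_then -1ℤ ℤ.^ length (factors f′) else 0ℤ)
    (dec-false (unique? (factors f′)) (repeated ∘ Unique-resp-↭ factors-*))
    where
    p∈factors : p ∈ factors f
    p∈factors = factorisationHasAllPrimeFactors p-prime (subst (p ∣_) isFactorisation p∣e) factorsPrime

    repeated : ¬ Unique (p ∷ factors f)
    repeated (p∉ ∷ _) = All¬⇒¬Any p∉ p∈factors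

  -- Here `p` is a new factor: the list becomes one entry longer, and it is free of repetitions
  -- exactly when the list for `e` is.
  μ[p*e]≡-μ[e] : ¬ p ∣ e → μ n ≡ ℤ.- μ e
  μ[p*e]≡-μ[e] p∤e with unique? (factors f)
  ... | yes u = begin
    μ n                         ≡⟨ cong (if_then -1ℤ ℤ.^ length (factors f′) else 0ℤ) (dec-true (unique? (factors f′)) (Unique-resp-↭ (↭-sym factors-*) (p∉factors ∷ u))) ⟩
    -1ℤ ℤ.^ length (factors f′)       ≡⟨ cong (-1ℤ ℤ.^_) (↭-length factors-*) ⟩
    -1ℤ ℤ.* -1ℤ ℤ.^ length (factors f) ≡⟨ ℤₚ.-1*i≡-i _ ⟩
    ℤ.- (-1ℤ ℤ.^ length (factors f))  ∎
    where
    open ≡-Reasoning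
    p∉factors : All (p ≢_) (factors f)
    p∉factors = ¬Any⇒All¬ _ λ p∈ → p∤e (subst (p ∣_) (sym isFactorisation) (∈⇒∣product p∈))
  -- In this branch `μ e` has computed to zero, and so has its negative.
  ... | no ¬u = cong (if_then -1ℤ ℤ.^ length (factors f′) else 0ℤ)
    (dec-false (unique? (factors f′)) (λ u → ¬u (tail (Unique-resp-↭ factors-* u))))
    where
    tail : ∀ {x xs} → Unique (x ∷ xs) → Unique xs
    tail (_ ∷ u) = u

primeDivisor : ∀ n → ∃ λ p → Prime p × p ∣ suc (suc n)
primeDivisor n with factorise (suc (suc n))
... | record { factors = [] ; isFactorisation = () }
... | record { factors = p ∷ ps ; isFactorisation = eq ; factorsPrime = p-prime ∷ _ } =
  p , p-prime , subst (p ∣_) (sym eq) (m∣m*n (product ps))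

prime∤⇒coprime : ∀ {p d} → Prime p → ¬ p ∣ d → Coprime d p
prime∤⇒coprime p-prime p∤d (k∣d , k∣p) with prime⇒irreducible p-prime k∣p
... | inj₁ k≡1  = k≡1
... | inj₂ refl = contradiction k∣d p∤d

-- Write `s` as `q * p`. As `e` is coprime to `p`, it divides `q`; multiplying by `p` gives the
-- claim.
prime∤⇒*-∣ : ∀ {p e s} → Prime p → ¬ p ∣ e → p ∣ s → e ∣ s → p ℕ.* e ∣ s
prime∤⇒*-∣ {p} {e} p-prime p∤e (divides q refl) e∣s = subst (p ℕ.* e ∣_) (ℕₚ.*-comm p q)
  (*-monoʳ-∣ p (coprime-divisor (prime∤⇒coprime p-prime p∤e) (subst (e ∣_) (ℕₚ.*-comm q p) e∣s)))

-- Divisor sums of the Möbius function.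

module MöbiusSums where
  open SumProperties ℤₚ.+-*-commutativeRing

  -- The divisors of s + 1 not divisible by p cancel against their products with p,
  -- and μ vanishes on the remaining divisors.
  module _ (n s p : ℕ) (s<n : s < n) (p-prime : Prime p) (p∣s : p ∣ suc s) where
    private
      open ≡-Reasoning
      instance _ = prime⇒nonZero p-prime

      term coprimeTerm : Vector ℤ n
      term d = μ (suc (toℕ d)) when (suc (toℕ d) ∣? suc s)
      coprimeTerm d = term d when ¬? (p ∣? suc (toℕ d))

      p*_≟_ : (e d : Fin n) → Dec (suc (toℕ d) ≡ p ℕ.* suc (toℕ e))
      p* e ≟ d = suc (toℕ d) ℕₚ.≟ p ℕ.* suc (toℕ e)

      pred-bound : ∀ {k m} → suc k ∣ suc m → m < n → k < n
      pred-bound d m<n = ℕₚ.<-≤-trans (∣⇒≤ d) m<n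

      -- A multiple of `p` has exactly one cofactor `e`, so the inner sum returns its term once; for
      -- any other `d` the inner sum vanishes and `coprimeTerm` takes over. The detour through `e`
      -- prepares an exchange of summations.
      split : ∀ d → term d ≡ coprimeTerm d ℤ.+ sum (λ e → term d when (p* e ≟ d))
      split d with p ∣? suc (toℕ d)
      ... | no p∤d = sym (trans
        (cong (λ x → term d ℤ.+ x) (sum-when-none (λ e → p* e ≟ d) _ λ e eq → contradiction (divides (suc (toℕ e)) (trans eq (ℕₚ.*-comm p _))) p∤d))
        (ℤₚ.+-identityʳ _))
      -- The number at `d` is positive, so its quotient by `p` is a successor; `q` is the shifted
      -- index of the quotient and lies below `n` because the quotient divides that number.
      ... | yes (divides (suc q) eq) = sym (trans
        (ℤₚ.+-identityˡ _)
        (sum-when-single (λ e → p* e ≟ d) (λ _ → term d) e (trans eq p*e)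
          λ e′ eq′ → toℕ-injective (ℕₚ.suc-injective (ℕₚ.*-cancelˡ-≡ _ _ p (trans (sym eq′) (trans eq p*e))))))
        where
        q<n : q < n
        q<n = pred-bound (subst (suc q ∣_) (sym eq) (m∣m*n p)) (toℕ<n d)
        e = fromℕ< q<n
        p*e : suc q ℕ.* p ≡ p ℕ.* suc (toℕ e)
        p*e = trans (ℕₚ.*-comm (suc q) p) (cong (λ x → p ℕ.* suc x) (sym (toℕ-fromℕ< q<n)))

      -- Let `e` and `s` stand for the shifted numbers. If `p` divides `e`, then `p * e` has a
      -- repeated prime factor and `μ` vanishes there. If `e` does not divide `s`, neither does
      -- `p * e`. Otherwise `p * e` divides `s` by coprimality, and the new prime flips the sign.
      multiples : ∀ e → sum (λ d → term d when (p* e ≟ d)) ≡ ℤ.- coprimeTerm e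
      multiples e = go (p ∣? suc (toℕ e)) (suc (toℕ e) ∣? suc s)
        where
        go : Dec (p ∣ suc (toℕ e)) → Dec (suc (toℕ e) ∣ suc s) →
             sum (λ d → term d when (p* e ≟ d)) ≡ ℤ.- coprimeTerm e
        go (yes p∣e) _ = trans
          (sum-when-none (p* e ≟_) term λ d eq →
            when-zero (suc (toℕ d) ∣? suc s) λ _ → μ[p*e]≡0 p-prime eq p∣e)
          (cong ℤ.-_ (sym (when-false (¬? (p ∣? suc (toℕ e))) (contradiction p∣e))))
        go (no p∤e) (no e∤s) = trans
          (sum-when-none (p* e ≟_) term λ d eq →
            when-false (suc (toℕ d) ∣? suc s) (e∤s ∘ ∣-trans (divides p eq)))
          (cong ℤ.-_ (sym (when-zero (¬? (p ∣? suc (toℕ e))) λ _ → when-false (suc (toℕ e) ∣? suc s) e∤s)))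
        go (no p∤e) (yes e∣s) = begin
          sum (λ d → term d when (p* e ≟ d))  ≡⟨ sum-when-single (p* e ≟_) term d d≡p*e (λ d′ eq → toℕ-injective (ℕₚ.suc-injective (trans eq (sym d≡p*e)))) ⟩
          term d                              ≡⟨ when-true (suc (toℕ d) ∣? suc s) (subst (_∣ suc s) (sym d≡p*e) p*e∣s) ⟩
          μ (suc (toℕ d))                     ≡⟨ μ[p*e]≡-μ[e] p-prime d≡p*e p∤e ⟩
          ℤ.- μ (suc (toℕ e))                 ≡⟨ cong ℤ.-_ (when-true (suc (toℕ e) ∣? suc s) e∣s) ⟨
          ℤ.- term e                          ≡⟨ cong ℤ.-_ (when-true (¬? (p ∣? suc (toℕ e))) p∤e) ⟨
          ℤ.- coprimeTerm e                   ∎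
          where
          p*e∣s : p ℕ.* suc (toℕ e) ∣ suc s
          p*e∣s = prime∤⇒*-∣ p-prime p∤e p∣s e∣s

          instance _ = ℕₚ.m*n≢0 p (suc (toℕ e))

          -- A divisor of `suc s` is at most `suc s`, hence at most `n` by `s<n`, so `p * e` is
          -- among the numbers summed over.
          p*e≤n : suc (pred (p ℕ.* suc (toℕ e))) ≤ n
          p*e≤n = ℕₚ.≤-trans (ℕₚ.≤-reflexive (ℕₚ.suc-pred _)) (ℕₚ.≤-trans (∣⇒≤ p*e∣s) s<n)

          d = fromℕ< p*e≤n

          d≡p*e : suc (toℕ d) ≡ p ℕ.* suc (toℕ e)
          d≡p*e = trans (cong suc (toℕ-fromℕ< p*e≤n)) (ℕₚ.suc-pred _)

    divisorSum-μ≡0 : divisorSum {n} (λ d → μ (suc (toℕ d))) s ≡ 0ℤ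
    divisorSum-μ≡0 = begin
      sum term
        ≡⟨ sum-cong-≋ split ⟩
      sum (λ d → coprimeTerm d ℤ.+ sum (λ e → term d when (p* e ≟ d)))
        ≡⟨ ∑-distrib-+ coprimeTerm _ ⟩
      sum coprimeTerm ℤ.+ sum (λ d → sum (λ e → term d when (p* e ≟ d)))
        -- Exchanging the sums groups the multiples of `p` by their cofactor `e`.
        ≡⟨ cong (λ x → sum coprimeTerm ℤ.+ x) (∑-comm {n} {n} λ d e → term d when (p* e ≟ d)) ⟩
      sum coprimeTerm ℤ.+ sum (λ e → sum (λ d → term d when (p* e ≟ d)))
        ≡⟨ cong (λ x → sum coprimeTerm ℤ.+ x) (sum-cong-≋ multiples) ⟩
      sum coprimeTerm ℤ.+ sum (λ e → ℤ.- coprimeTerm e)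
        ≡⟨ ∑-distrib-+ coprimeTerm _ ⟨
      sum (λ d → coprimeTerm d ℤ.+ ℤ.- coprimeTerm d)
        ≡⟨ sum≈0 {n} _ (λ d → ℤₚ.+-inverseʳ (coprimeTerm d)) ⟩
      0ℤ  ∎

  divisorSum-μ[1] : ∀ n → divisorSum {suc n} (λ d → μ (suc (toℕ d))) 0 ≡ 1ℤ
  divisorSum-μ[1] n = sum-when-single {suc n} (λ d → suc (toℕ d) ∣? 1) (λ d → μ (suc (toℕ d))) zero ∣-refl
    λ d d∣1 → toℕ-injective (ℕₚ.n≤0⇒n≡0 (s≤s⁻¹ (∣⇒≤ d∣1)))

  divisorSum-μ[>1] : ∀ {n s} → suc s < n → divisorSum {n} (λ d → μ (suc (toℕ d))) (suc s) ≡ 0ℤ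
  divisorSum-μ[>1] {n} {s} s<n with p , p-prime , p∣s ← primeDivisor s =
    divisorSum-μ≡0 n (suc s) p s<n p-prime p∣s

-- Integers and natural numbers inside the rationals.

open import Data.Rational.Base using (ℚ; 0ℚ; 1ℚ; _+_; _*_; _/_; +-*-rawRing; fromℚᵘ; toℚᵘ)
import Data.Rational.Base as ℚ

-- `toℚᵘ` is injective, so the comparison moves to unnormalised fractions, where it undoes `fromℚᵘ`
-- up to equivalence. Sums and negatives are treated likewise.
fromℚᵘ-homo-* : ∀ p q → fromℚᵘ (p ℚᵘ.* q) ≡ fromℚᵘ p * fromℚᵘ q
fromℚᵘ-homo-* p q = ℚₚ.toℚᵘ-injective (begin
  toℚᵘ (fromℚᵘ (p ℚᵘ.* q))                 ≈⟨ ℚₚ.toℚᵘ-fromℚᵘ (p ℚᵘ.* q) ⟩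
  p ℚᵘ.* q                                 ≈⟨ ℚᵘₚ.*-cong (ℚₚ.toℚᵘ-fromℚᵘ p) (ℚₚ.toℚᵘ-fromℚᵘ q) ⟨
  toℚᵘ (fromℚᵘ p) ℚᵘ.* toℚᵘ (fromℚᵘ q)     ≈⟨ ℚₚ.toℚᵘ-homo-* (fromℚᵘ p) (fromℚᵘ q) ⟨
  toℚᵘ (fromℚᵘ p * fromℚᵘ q)               ∎)
  where open import Relation.Binary.Reasoning.Setoid ℚᵘₚ.≃-setoid

fromℚᵘ-homo-+ : ∀ p q → fromℚᵘ (p ℚᵘ.+ q) ≡ fromℚᵘ p + fromℚᵘ q
fromℚᵘ-homo-+ p q = ℚₚ.toℚᵘ-injective (begin
  toℚᵘ (fromℚᵘ (p ℚᵘ.+ q))                 ≈⟨ ℚₚ.toℚᵘ-fromℚᵘ (p ℚᵘ.+ q) ⟩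
  p ℚᵘ.+ q                                 ≈⟨ ℚᵘₚ.+-cong (ℚₚ.toℚᵘ-fromℚᵘ p) (ℚₚ.toℚᵘ-fromℚᵘ q) ⟨
  toℚᵘ (fromℚᵘ p) ℚᵘ.+ toℚᵘ (fromℚᵘ q)     ≈⟨ ℚₚ.toℚᵘ-homo-+ (fromℚᵘ p) (fromℚᵘ q) ⟨
  toℚᵘ (fromℚᵘ p + fromℚᵘ q)               ∎)
  where open import Relation.Binary.Reasoning.Setoid ℚᵘₚ.≃-setoid

fromℚᵘ-homo‿- : ∀ p → fromℚᵘ (ℚᵘ.- p) ≡ ℚ.- fromℚᵘ p
fromℚᵘ-homo‿- p = ℚₚ.toℚᵘ-injective (begin
  toℚᵘ (fromℚᵘ (ℚᵘ.- p))    ≈⟨ ℚₚ.toℚᵘ-fromℚᵘ (ℚᵘ.- p) ⟩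
  ℚᵘ.- p                    ≈⟨ ℚᵘₚ.-‿cong (ℚₚ.toℚᵘ-fromℚᵘ p) ⟨
  ℚᵘ.- toℚᵘ (fromℚᵘ p)      ≈⟨ ℚₚ.toℚᵘ-homo‿- (fromℚᵘ p) ⟨
  toℚᵘ (ℚ.- fromℚᵘ p)       ∎)
  where open import Relation.Binary.Reasoning.Setoid ℚᵘₚ.≃-setoid

fromℤ : ℤ → ℚ
fromℤ i = i / 1

fromℤ-isRingHomomorphism : IsRingHomomorphism ℤ.+-*-rawRing +-*-rawRing fromℤ
fromℤ-isRingHomomorphism = record
  { isSemiringHomomorphism = record
    { isNearSemiringHomomorphism = record
      { +-isMonoidHomomorphism = record
        { isMagmaHomomorphism = record
          { isRelHomomorphism = record { cong = cong fromℤ }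
          -- Unnormalised addition yields the numerator `i * 1 + j * 1`; multiplication and negation
          -- over the denominator 1 compute directly.
          ; homo = λ i j → trans
              (cong fromℤ (sym (cong₂ ℤ._+_ (ℤₚ.*-identityʳ i) (ℤₚ.*-identityʳ j))))
              (fromℚᵘ-homo-+ (mkℚᵘ i 0) (mkℚᵘ j 0))
          }
        ; ε-homo = refl
        }
      ; *-homo = λ i j → fromℚᵘ-homo-* (mkℚᵘ i 0) (mkℚᵘ j 0)
      }
    ; 1#-homo = refl
    }
  ; -‿homo = λ i → fromℚᵘ-homo‿- (mkℚᵘ i 0)
  }

fromℕ-* : ∀ m n → fromℕ (m ℕ.* n) ≡ fromℕ m * fromℕ n
fromℕ-* m n = trans (cong fromℤ (ℤₚ.pos-* m n)) (fromℚᵘ-homo-* (mkℚᵘ (+ m) 0) (mkℚᵘ (+ n) 0))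

-- The fractions are compared before normalisation, by cross-multiplying `n * i` over `1 * n` with
-- `i` over 1.
fromℕ-*-/ : ∀ n i .{{_ : NonZero n}} → fromℕ n * (i / n) ≡ fromℤ i
fromℕ-*-/ n@(suc d) i = trans
  (sym (fromℚᵘ-homo-* (mkℚᵘ (+ n) 0) (mkℚᵘ i d)))
  (ℚₚ.fromℚᵘ-cong {mkℚᵘ (+ n) 0 ℚᵘ.* mkℚᵘ i d} {mkℚᵘ i 0} (*≡* (begin
    (+ n ℤ.* i) ℤ.* 1ℤ         ≡⟨ ℤₚ.*-identityʳ _ ⟩
    + n ℤ.* i                  ≡⟨ ℤₚ.*-comm (+ n) i ⟩
    i ℤ.* + n                  ≡⟨ cong (λ m → i ℤ.* + m) (ℕₚ.*-identityˡ n) ⟨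
    i ℤ.* + (1 ℕ.* n)          ∎)))
  where open ≡-Reasoning

-- Cofactors and determinant of the Fibonacci-Redheffer matrix.

module FibonacciRedheffer where
  open MöbiusSums using (divisorSum-μ[1]; divisorSum-μ[>1])
  module ℤΣ = SumProperties ℤₚ.+-*-commutativeRing
  ℚ-ring = ℚₚ.+-*-commutativeRing
  open SumProperties ℚ-ring
  open DeterminantProperties ℚ-ring
  open ≡-Reasoning
  import Algebra.Properties.CommutativeMonoid.Sum ℚₚ.*-1-commutativeMonoid as Product
  open import Algebra.Properties.CommutativeSemigroup (CommutativeRing.*-commutativeSemigroup ℚ-ring)
    using (x∙yz≈y∙xz)

  F : ∀ {n} → Vector ℚ n
  F i = fromℕ (fib (suc (toℕ i)))

  -- `_!F` appends its newest factor at the end while `Product.sum` peels off the first, so the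
  -- product is split at its last index.
  fromℕ-!F : ∀ n → fromℕ (n !F) ≡ Product.sum (F {n})
  fromℕ-!F zero    = refl
  fromℕ-!F (suc n) = begin
    fromℕ (n !F ℕ.* fib (suc n))                 ≡⟨ fromℕ-* (n !F) (fib (suc n)) ⟩
    fromℕ (n !F) * fromℕ (fib (suc n))           ≡⟨ cong₂ _*_ (fromℕ-!F n) (cong (fromℕ ∘ fib ∘ suc) (sym (toℕ-fromℕ n))) ⟩
    Product.sum (F {n}) * F (Fin.fromℕ n)        ≡⟨ cong (_* F (Fin.fromℕ n)) (Product.sum-cong-≗ {n} λ i → cong (fromℕ ∘ fib ∘ suc) (toℕ-inject₁ i)) ⟨
    Product.sum {n} (F ∘ inject₁) * F (Fin.fromℕ n)  ≡⟨ Product.sum-init-last (F {suc n}) ⟨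
    Product.sum (F {suc n})                      ∎

  module _ (n : ℕ) where
    A : Matrix ℚ (suc n)
    A = fibRedheffer (suc n)

    N = fromℕ (suc n !F)

    weightedCofactor : Vector ℚ (suc n)
    weightedCofactor i = F i * cofactor A i

    -- Counted from 1, `suc s` is column 2 or later, so the clause for column 1 does not apply.
    entry : ∀ i s → A i (suc s) ≡ (F i when (suc (toℕ i) ∣? suc (toℕ (suc s))))
    entry i s = if-float fromℕ (does (suc (toℕ i) ∣? suc (toℕ (suc s))))

    lower-zero : ∀ i j → j Fin.< i → minor A zero i j ≡ 0ℚ
    lower-zero i j j<i = trans (entry (suc i) j)
      (when-false (suc (toℕ (suc i)) ∣? suc (toℕ (suc j))) (λ d → ℕₚ.<⇒≱ (s≤s (s≤s j<i)) (∣⇒≤ d)))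

    diagonal : ∀ i → minor A zero i i ≡ F (suc i)
    diagonal i = trans (entry (suc i) i) (when-true (suc (toℕ (suc i)) ∣? suc (toℕ (suc i))) ∣-refl)

    weightedCofactor₀ : weightedCofactor zero ≡ N
    weightedCofactor₀ = begin
      1ℚ * (1ℚ * ∣ minor A zero ∣)                    ≡⟨ cong (λ x → 1ℚ * x) (ℚₚ.*-identityˡ ∣ minor A zero ∣) ⟩
      1ℚ * ∣ minor A zero ∣                           ≡⟨ cong (λ x → 1ℚ * x) (det-upperTriangular (minor A zero) lower-zero) ⟩
      -- The diagonal of the minor starts at F_2; the leading `1ℚ`, which is `F zero`, supplies F_1.
      1ℚ * Product.sum (λ i → minor A zero i i)       ≡⟨ cong (λ x → 1ℚ * x) (Product.sum-cong-≗ diagonal) ⟩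
      Product.sum (F {suc n})                         ≡⟨ fromℕ-!F (suc n) ⟨
      N                                               ∎

    μ′ : Vector ℤ (suc n)
    μ′ k = μ (suc (toℕ k))

    N*μ : Vector ℚ (suc n)
    N*μ k = N * fromℤ (μ′ k)

    divisorSum-N*μ : ∀ s → divisorSum N*μ s ≡ N * fromℤ (ℤΣ.divisorSum μ′ s)
    divisorSum-N*μ s = sym (begin
      N * fromℤ (ℤΣ.divisorSum μ′ s)
        ≡⟨ cong (λ x → N * x) (sum-homo fromℤ-isRingHomomorphism term) ⟩
      N * sum {suc n} (λ k → fromℤ (term k))
        ≡⟨ *-distribˡ-sum N (λ k → fromℤ (term k)) ⟩
      sum {suc n} (λ k → N * fromℤ (term k))
        ≡⟨ sum-cong-≗ {suc n} (λ k → float (μ′ k) (does (suc (toℕ k) ∣? suc s))) ⟩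
      divisorSum N*μ s  ∎)
      where
      term : Vector ℤ (suc n)
      term k = μ′ k ℤΣ.when (suc (toℕ k) ∣? suc s)

      float : ∀ x b → N * fromℤ (if b then x else 0ℤ) ≡ (if b then N * fromℤ x else 0ℚ)
      float x true  = refl
      float x false = ℚₚ.*-zeroʳ N

    divisorSum-weightedCofactor : ∀ (s : Fin (suc n)) →
                                  divisorSum weightedCofactor (toℕ s) ≡ divisorSum N*μ (toℕ s)
    divisorSum-weightedCofactor zero = begin
      divisorSum weightedCofactor 0                 ≡⟨ sum-when-single {suc n} (λ i → suc (toℕ i) ∣? 1) weightedCofactor zero ∣-refl (λ i i∣1 → toℕ-injective (ℕₚ.n≤0⇒n≡0 (s≤s⁻¹ (∣⇒≤ i∣1)))) ⟩
      weightedCofactor zero                         ≡⟨ weightedCofactor₀ ⟩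
      N                                             ≡⟨ ℚₚ.*-identityʳ N ⟨
      N * fromℤ 1ℤ                                  ≡⟨ cong (λ x → N * fromℤ x) (divisorSum-μ[1] n) ⟨
      N * fromℤ (ℤΣ.divisorSum μ′ 0)                ≡⟨ divisorSum-N*μ 0 ⟨
      divisorSum N*μ 0                              ∎
    divisorSum-weightedCofactor (suc s) = begin
      -- The divisor condition is built into column `suc s`, which holds `F i` at divisors and zero
      -- elsewhere, so the divisor sum is an alien cofactor expansion.
      divisorSum weightedCofactor (suc (toℕ s))                ≡⟨ sum-cong-≗ {suc n} (λ i → trans (cong (_* cofactor A i) (entry i s)) (when-*ʳ (F i) (cofactor A i) (suc (toℕ i) ∣? suc (suc (toℕ s))))) ⟨
      sum (λ i → A i (suc s) * cofactor A i)                   ≡⟨ laplace-alien A s ⟩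
      0ℚ                                                       ≡⟨ ℚₚ.*-zeroʳ N ⟨
      N * fromℤ 0ℤ                                             ≡⟨ cong (λ x → N * fromℤ x) (divisorSum-μ[>1] (s≤s (toℕ<n s))) ⟨
      N * fromℤ (ℤΣ.divisorSum μ′ (suc (toℕ s)))               ≡⟨ divisorSum-N*μ (suc (toℕ s)) ⟨
      divisorSum N*μ (suc (toℕ s))                             ∎

    -- `divisorSum-injective` gives the cofactor weighted by `F k`; multiplying by the explicit
    -- inverse of this positive Fibonacci number removes the weight.
    cofactor≡ : ∀ k → cofactor A k ≡ N * μ/F (suc (toℕ k))
    cofactor≡ k = begin
      cofactor A k                               ≡⟨ ℚₚ.*-identityˡ _ ⟨
      1ℚ * cofactor A k                          ≡⟨ cong (_* cofactor A k) F⁻¹*F ⟨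
      F⁻¹ * F k * cofactor A k                   ≡⟨ ℚₚ.*-assoc F⁻¹ (F k) _ ⟩
      F⁻¹ * weightedCofactor k                   ≡⟨ cong (λ x → F⁻¹ * x) (divisorSum-injective weightedCofactor N*μ divisorSum-weightedCofactor k) ⟩
      F⁻¹ * (N * fromℤ (μ′ k))                   ≡⟨ cong (λ x → F⁻¹ * (N * x)) (fromℕ-*-/ (fib (suc (toℕ k))) (μ′ k)) ⟨
      F⁻¹ * (N * (F k * μ/F (suc (toℕ k))))      ≡⟨ cong (λ x → F⁻¹ * x) (x∙yz≈y∙xz N (F k) _) ⟩
      F⁻¹ * (F k * (N * μ/F (suc (toℕ k))))      ≡⟨ ℚₚ.*-assoc F⁻¹ (F k) _ ⟨
      F⁻¹ * F k * (N * μ/F (suc (toℕ k)))        ≡⟨ cong (_* (N * μ/F (suc (toℕ k)))) F⁻¹*F ⟩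
      1ℚ * (N * μ/F (suc (toℕ k)))               ≡⟨ ℚₚ.*-identityˡ _ ⟩
      N * μ/F (suc (toℕ k))                      ∎
      where
      instance _ = fib-nonZero (toℕ k)
      F⁻¹ = 1ℤ / fib (suc (toℕ k))
      F⁻¹*F : F⁻¹ * F k ≡ 1ℚ
      F⁻¹*F = trans (ℚₚ.*-comm F⁻¹ (F k)) (fromℕ-*-/ (fib (suc (toℕ k))) 1ℤ)

    det-fibRedheffer : ∣ A ∣ ≡ N * sum (λ (k : Fin (suc n)) → μ/F (suc (toℕ k)))
    det-fibRedheffer = begin
      ∣ A ∣                                                       ≡⟨ laplace A ⟩
      sum (λ k → A k zero * cofactor A k)                         ≡⟨ sum-cong-≗ {suc n} (λ k → trans (ℚₚ.*-identityˡ (cofactor A k)) (cofactor≡ k)) ⟩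
      sum (λ (k : Fin (suc n)) → N * μ/F (suc (toℕ k)))           ≡⟨ *-distribˡ-sum {suc n} N (λ k → μ/F (suc (toℕ k))) ⟨
      N * sum (λ (k : Fin (suc n)) → μ/F (suc (toℕ k)))           ∎

theorem1 : {c ℓ₁ ℓ₂ : Level} (n : ℕ) → .{{_ : NonZero n}} →
  let D = det +-*-rawRing (fibRedheffer n)
      S = fromℕ (n !F) * ∑ +-*-rawRing (λ (k : Fin n) → μ/F (suc (toℕ k)))
  in
    (D ≡ S) ×
    ((K : ExtensionOfℚ c ℓ₁ ℓ₂) → let open ExtensionOfℚ K in
      (λs : Vector Carrier n) →
      AreEigenvaluesOf rawRing λs (λ i j → ι (fibRedheffer n i j)) →
      (ι D ≈ ∏ rawRing λs) × (∏ rawRing λs ≈ ι S))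
theorem1 n@(suc m) = det≡ , λ K λs eigenvalues →
  let open ExtensionOfℚ K
      open CommutativeRing commutativeRing using () renaming (sym to ≈-sym; trans to ≈-trans; reflexive to ≈-reflexive)
      -- The rational determinant is first carried along `ι` entrywise, since the eigenvalues in `K`
      -- belong to the matrix over `K`.
      ιD≈∏ = ≈-trans
        (DeterminantProperties.det-homo commutativeRing ι-homomorphism (fibRedheffer n))
        (EigenvalueProperties.det≈product-eigenvalues commutativeRing (λ i j → ι (fibRedheffer n i j)) λs eigenvalues)
  in ιD≈∏ , ≈-trans (≈-sym ιD≈∏) (≈-reflexive (cong ι det≡))
  where
  det≡ = FibonacciRedheffer.det-fibRedheffer m
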